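{- For every integer $k\geq 2$, none of the sequences $(\rho(n))_{n\geq 1}$, $(\tau(n^2))_{n\geq 1}$, $(\tau^2(n))_{n\geq 1}$ is $k$-regular, where $\tau(n)$ is the number of positive divisors of $n$ and $\rho(n)=2^{\omega(n)}$ with $\omega(n)$ the number of distinct prime divisors of $n$.
   Context: An integer sequence $(s(n))$ is $k$-regular if its $k$-kernel $\{(s(k^l n+r))_{n}: l\geq 0,\ 0\leq r<k^l\}$ is contained in the $\mathbb{Z}$-linear span of finitely many integer sequences. -}

module Defs where

open import Data.Nat using (ℕ; zero; suc; _+_; _*_; _^_; _<_; _≤_)
open import Data.Nat.Divisibility using (_∣_; _∣?_)
open import Data.Nat.Primality using (Prime; prime?)
open import Data.Integer using (ℤ; +_)
import Data.Integer as ℤ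
open import Data.List using (List; length; filter; map; upTo)
open import Data.Fin using (Fin)
import Data.Fin
open import Data.Product using (Σ; _×_)
open import Relation.Nullary.Decidable using (_×-dec_)
open import Relation.Binary.PropositionalEquality using (_≡_)

range1 : ℕ → List ℕ
range1 n = map suc (upTo n)

τ : ℕ → ℕ
τ n = length (filter (λ d → d ∣? n) (range1 n))

ω : ℕ → ℕ
ω n = length (filter (λ p → prime? p ×-dec (p ∣? n)) (range1 n))

ρ : ℕ → ℕ
ρ n = 2 ^ ω n

linComb : (m : ℕ) → (Fin m → ℤ) → (Fin m → ℕ → ℤ) → ℕ → ℤ
linComb zero    c g n = + 0
linComb (suc m) c g n =
  c Data.Fin.zero ℤ.* g Data.Fin.zero n ℤ.+ linComb m (λ i → c (Data.Fin.suc i)) (λ i → g (Data.Fin.suc i)) n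

-- s is k-regular: the k-kernel {(s(k^l n + r))_n : l ≥ 0, 0 ≤ r < k^l}
-- lies in the ℤ-linear span of finitely many integer sequences g_0..g_{m-1}.
IsRegular : ℕ → (ℕ → ℤ) → Set
IsRegular k s =
  Σ ℕ λ m → Σ (Fin m → ℕ → ℤ) λ g →
    (l r : ℕ) → r < k ^ l →
      Σ (Fin m → ℤ) λ c → (n : ℕ) → s (k ^ l * n + r) ≡ linComb m c g n

-- A sequence (a(n))_{n ≥ 1} of naturals, viewed as an integer sequence
-- indexed by ℕ, with the (irrelevant) convention value 0 at index 0.
seq₁ : (ℕ → ℕ) → ℕ → ℤ
seq₁ a zero    = + 0
seq₁ a (suc n) = + a (suc n)

{-# OPTIONS --safe #-}
module Submission where

-- If the kernel lies in the span of m sequences, every matrix of entries s(k^l n + r), with rows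
-- (l , r) and columns n, has rank at most m. For each of the three sequences f there is a prime q such
-- that f(p x) is divisible by q f(x) for primes p ∤ x, whereas f(N⁶) is not divisible by a fixed power
-- q^b when N = (k+1)^a k^C, since τ(x⁶) ≡ 1 (mod 6) and since the number of primes dividing N is
-- bounded. Rows and columns are chosen alternately: by the Chinese remainder theorem the new column n
-- makes f(k^l n + r) divisible by a huge power of q for all earlier rows, and then the new row is
-- chosen with k^l n + r = N⁶, which exists since the numbers N⁶ have arbitrary leading digits in
-- base k. The resulting matrix is triangular modulo a huge power of q, so it has full rank.

open import Defs
open import Data.Nat
open import Data.Nat.Properties
open import Data.Nat.Divisibility
open import Data.Nat.DivMod using (m/n*n≤m; m<n*o⇒m/o<n; m≡m%n+[m/n]*n; m%n<n)
open import Data.Nat.GCD using (module Bézout)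
open import Data.Nat.Primality
open import Data.Nat.Primality.Factorisation using (factorise; module PrimeFactorisation)
open import Data.Nat.Coprimality as Coprime using (Coprime; coprime-divisor; coprime-Bézout)
open import Data.Nat.Induction using (<-rec)
open import Data.Nat.ListAction using (product)
open import Data.Nat.Tactic.RingSolver using (solve-∀)
open import Data.Integer as ℤ using (ℤ) renaming (+_ to pos)
open import Data.Integer.Properties using (abs-*)
open import Data.Integer.Divisibility.Signed as ℤ using (∣ᵤ⇒∣; ∣⇒∣ᵤ) renaming (_∣_ to _∣ℤ_; _∣?_ to _∣ℤ?_)
open import Data.Integer.Tactic.RingSolver using () renaming (solve-∀ to solveℤ-∀)
open import Data.Fin as Fin using (Fin; punchIn; toℕ; fromℕ<)
open import Data.Fin.Properties using (¬∀⟶∃¬; pigeonhole; toℕ-fromℕ<)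
open import Data.List using (List; []; _∷_; _++_; length; filter; map; upTo)
open import Data.List.Properties using (length-map; length-++; length-upTo; length-filter)
open import Data.List.Membership.Propositional using (_∈_)
open import Data.List.Membership.Propositional.Properties
  using (∈-map⁺; ∈-map⁻; ∈-++⁺ˡ; ∈-++⁺ʳ; ∈-++⁻; ∈-filter⁺; ∈-filter⁻; ∈-upTo⁺)
open import Data.List.Membership.Propositional.Properties.WithK using (unique∧set⇒bag)
open import Data.List.Relation.Binary.BagAndSetEquality using (∼bag⇒↭)
open import Data.List.Relation.Binary.Permutation.Propositional.Properties using (↭-length)
open import Data.List.Relation.Unary.Any using (here; there)
open import Data.List.Relation.Unary.All as All using (All; []; _∷_)
import Data.List.Relation.Unary.All.Properties as All
open import Data.List.Relation.Unary.AllPairs as AllPairs using (AllPairs; []; _∷_)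
open import Data.List.Relation.Unary.Unique.Propositional using (Unique)
import Data.List.Relation.Unary.Unique.Propositional.Properties as Unique
open import Data.Empty using (⊥)
open import Data.Product using (∃; ∃₂; _×_; _,_; proj₁; proj₂)
open import Data.Sum using (_⊎_; inj₁; inj₂; [_,_]′)
open import Function using (_∘_; id)
open import Function.Bundles using (mk⇔)
open import Relation.Nullary using (¬_; Dec; yes; no; contradiction)
open import Relation.Nullary.Decidable using (_×-dec_; from-yes)
open import Relation.Binary using (Tri; tri<; tri≈; tri>)
open import Relation.Binary.PropositionalEquality

-- Divisor functions

-- Duplicate-free lists with the same members agree as bags, hence up to permutation. The values of
-- `τ` and `ω` are all compared in this way.
unique-length : ∀ {xs ys : List ℕ} → Unique xs → Unique ys →
  (∀ {d} → d ∈ xs → d ∈ ys) → (∀ {d} → d ∈ ys → d ∈ xs) → length xs ≡ length ys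
unique-length u v f g = ↭-length (∼bag⇒↭ (unique∧set⇒bag u v (mk⇔ f g)))

range1-unique : ∀ n → Unique (range1 n)
range1-unique n = Unique.map⁺ suc-injective (Unique.upTo⁺ n)

length-range1 : ∀ n → length (range1 n) ≡ n
length-range1 n = trans (length-map suc (upTo n)) (length-upTo n)

∈-range1⁺ : ∀ {d n} → 1 ≤ d → d ≤ n → d ∈ range1 n
∈-range1⁺ {suc d} _ d≤n = ∈-map⁺ suc (∈-upTo⁺ d≤n)

divisors : ℕ → List ℕ
divisors n = filter (λ d → d ∣? n) (range1 n)

primeDivisors : ℕ → List ℕ
primeDivisors n = filter (λ p → prime? p ×-dec (p ∣? n)) (range1 n)

prime>0 : ∀ {p} → Prime p → 0 < p
prime>0 {p} pp = >-nonZero⁻¹ p {{prime⇒nonZero pp}}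

∣⇒≤⁺ : ∀ {d n} → 1 ≤ n → d ∣ n → d ≤ n
∣⇒≤⁺ n≥1 = ∣⇒≤ {{>-nonZero n≥1}}

∣⇒>0 : ∀ {d n} → 1 ≤ n → d ∣ n → 1 ≤ d
∣⇒>0 {zero} n≥1 0∣n = contradiction (sym (0∣⇒≡0 0∣n)) (<⇒≢ n≥1)
∣⇒>0 {suc d} _ _ = s≤s z≤n

∈-divisors⁺ : ∀ {d n} → 1 ≤ n → d ∣ n → d ∈ divisors n
∈-divisors⁺ n≥1 d∣n = ∈-filter⁺ (λ d → d ∣? _) (∈-range1⁺ (∣⇒>0 n≥1 d∣n) (∣⇒≤⁺ n≥1 d∣n)) d∣n

∈-divisors⁻ : ∀ {d n} → d ∈ divisors n → d ∣ n
∈-divisors⁻ {n = n} p = proj₂ (∈-filter⁻ (λ d → d ∣? n) {xs = range1 n} p)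

divisors-unique : ∀ n → Unique (divisors n)
divisors-unique n = Unique.filter⁺ (λ d → d ∣? n) (range1-unique n)

∈-primeDivisors⁺ : ∀ {p n} → 1 ≤ n → Prime p → p ∣ n → p ∈ primeDivisors n
∈-primeDivisors⁺ n≥1 pp p∣n =
  ∈-filter⁺ (λ p → prime? p ×-dec (p ∣? _)) (∈-range1⁺ (prime>0 pp) (∣⇒≤⁺ n≥1 p∣n)) (pp , p∣n)

∈-primeDivisors⁻ : ∀ {p n} → p ∈ primeDivisors n → Prime p × p ∣ n
∈-primeDivisors⁻ {n = n} p = proj₂ (∈-filter⁻ (λ p → prime? p ×-dec (p ∣? n)) {xs = range1 n} p)

primeDivisors-unique : ∀ n → Unique (primeDivisors n)
primeDivisors-unique n = Unique.filter⁺ (λ p → prime? p ×-dec (p ∣? n)) (range1-unique n)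

prime∤1 : ∀ {p} → Prime p → ¬ p ∣ 1
prime∤1 pp p∣1 = ¬prime[1] (subst Prime (∣1⇒≡1 p∣1) pp)

prime∣^⇒prime∣ : ∀ {p} → Prime p → ∀ x n → p ∣ x ^ n → p ∣ x
prime∣^⇒prime∣ pp x zero    p∣1 = contradiction p∣1 (prime∤1 pp)
prime∣^⇒prime∣ pp x (suc n) p∣  = [ id , prime∣^⇒prime∣ pp x n ]′ (euclidsLemma x (x ^ n) pp p∣)

prime∣prime⇒≡ : ∀ {p q} → Prime p → Prime q → p ∣ q → p ≡ q
prime∣prime⇒≡ pp pq p∣q with prime⇒irreducible pq p∣q
... | inj₁ refl = contradiction pp ¬prime[1]
... | inj₂ eq   = eq

-- Valuations at `p` add: at most `a` in `x` and less than `b` in `y` would leave less than `a + b`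
-- in the product. The induction cancels one `p` from a factor that it divides, lowering `b` if this
-- is `y` and `a` if it is `x`.
primePower-∣* : ∀ {p} → Prime p → ∀ a b x y → p ^ (a + b) ∣ x * y → p ^ suc a ∣ x ⊎ p ^ b ∣ y
primePower-∣* {p} pp a zero x y h = inj₂ (1∣ y)
primePower-∣* {p} pp a (suc b) x y h = go (euclidsLemma x y pp (m*n∣⇒m∣ p (p ^ (a + b)) h'))
  where
  instance _ = prime⇒nonZero pp
  h' : p * p ^ (a + b) ∣ x * y
  h' = subst (λ e → p ^ e ∣ x * y) (+-suc a b) h
  go : p ∣ x ⊎ p ∣ y → p ^ suc a ∣ x ⊎ p ^ suc b ∣ y
  go (inj₂ (divides-refl y')) with primePower-∣* pp a b x y'
      (*-cancelˡ-∣ p (subst (p * p ^ (a + b) ∣_) (lem x y' p) h'))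
    where
    lem : ∀ x y p → x * (y * p) ≡ p * (x * y)
    lem = solve-∀
  ... | inj₁ r = inj₁ r
  ... | inj₂ r = inj₂ (subst (p ^ suc b ∣_) (*-comm p y') (*-monoʳ-∣ p r))
  go (inj₁ (divides-refl x')) = descend a h'
    where
    lem : ∀ x y p → (x * p) * y ≡ p * (x * y)
    lem = solve-∀
    descend : ∀ a → p * p ^ (a + b) ∣ (x' * p) * y → p ^ suc a ∣ x' * p ⊎ p ^ suc b ∣ y
    descend zero    _ = inj₁ (subst (_∣ x' * p) (sym (*-identityʳ p)) (n∣m*n x'))
    descend (suc a) h with primePower-∣* pp a (suc b) x' y
        (subst (λ e → p ^ e ∣ x' * y) (sym (+-suc a b))
          (*-cancelˡ-∣ p (subst (p * p ^ (suc a + b) ∣_) (lem x' y p) h)))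
    ... | inj₁ r = inj₁ (subst (p ^ suc (suc a) ∣_) (*-comm p x') (*-monoʳ-∣ p r))
    ... | inj₂ r = inj₂ r

-- The divisors not already dividing `p ^ a * y` contain the full power of `p`, so they are
-- `p ^ suc a * e` with `e ∣ y`.
τ-primePower-suc : ∀ {p} → Prime p → ∀ a {y} → 1 ≤ y → ¬ p ∣ y →
  τ (p ^ suc a * y) ≡ τ (p ^ a * y) + τ y
τ-primePower-suc {p} pp a {y} y≥1 p∤y = begin
  length (divisors (p ^ suc a * y))
    ≡⟨ unique-length (divisors-unique (p ^ suc a * y)) unique to from ⟩
  length (divisors (p ^ a * y) ++ map (p ^ suc a *_) (divisors y))
    ≡⟨ length-++ (divisors (p ^ a * y)) ⟩
  τ (p ^ a * y) + length (map (p ^ suc a *_) (divisors y))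
    ≡⟨ cong (τ (p ^ a * y) +_) (length-map (p ^ suc a *_) (divisors y)) ⟩
  τ (p ^ a * y) + τ y ∎
  where
  open ≡-Reasoning
  instance
    _ = prime⇒nonZero pp
    _ = m^n≢0 p a
    _ = m^n≢0 p (suc a)
  positive : ∀ e → 1 ≤ p ^ e * y
  positive e = *-mono-≤ (m^n>0 p e) y≥1
  lem : ∀ p q e → p * q * e ≡ q * (p * e)
  lem = solve-∀
  disjoint : ∀ {d} → ¬ (d ∈ divisors (p ^ a * y) × d ∈ map (p ^ suc a *_) (divisors y))
  disjoint (l , r) with e , _ , refl ← ∈-map⁻ (p ^ suc a *_) r =
    p∤y (m*n∣⇒m∣ p e (*-cancelˡ-∣ (p ^ a) (subst (_∣ p ^ a * y) (lem p (p ^ a) e) (∈-divisors⁻ {n = p ^ a * y} l))))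
  unique : Unique (divisors (p ^ a * y) ++ map (p ^ suc a *_) (divisors y))
  unique = Unique.++⁺ (divisors-unique (p ^ a * y))
    (Unique.map⁺ (*-cancelˡ-≡ _ _ (p ^ suc a)) (divisors-unique y)) disjoint
  to : ∀ {d} → d ∈ divisors (p ^ suc a * y) → d ∈ divisors (p ^ a * y) ++ map (p ^ suc a *_) (divisors y)
  to {d} d∈ = split (∈-divisors⁻ {n = p ^ suc a * y} d∈)
    where
    split : d ∣ p ^ suc a * y → d ∈ divisors (p ^ a * y) ++ map (p ^ suc a *_) (divisors y)
    -- With `c` the cofactor of `d`, either `p ^ suc a` divides `d`, or `p` divides `c` and can be
    -- cancelled.
    split (divides c eq) with primePower-∣* pp a 1 d c
      (subst₂ (λ e z → p ^ e ∣ z) (+-comm 1 a) (trans eq (*-comm c d)) (m∣m*n {p ^ suc a} y))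
    ... | inj₁ (divides-refl e) = ∈-++⁺ʳ (divisors (p ^ a * y))
          (subst (_∈ map (p ^ suc a *_) (divisors y)) (*-comm (p ^ suc a) e)
            (∈-map⁺ (p ^ suc a *_) (∈-divisors⁺ y≥1
              (divides c (*-cancelˡ-≡ y (c * e) (p ^ suc a) (trans eq (lem₂ c e (p ^ suc a))))))))
      where
      lem₂ : ∀ c e q → c * (e * q) ≡ q * (c * e)
      lem₂ = solve-∀
    ... | inj₂ (divides c' refl) = ∈-++⁺ˡ (∈-divisors⁺ (positive a)
          (divides c' (*-cancelˡ-≡ (p ^ a * y) (c' * d) p
            (trans (sym (*-assoc p (p ^ a) y)) (trans eq (lem₃ c' p d))))))
      where
      lem₃ : ∀ c p d → c * (p * 1) * d ≡ p * (c * d)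
      lem₃ = solve-∀
  from : ∀ {d} → d ∈ divisors (p ^ a * y) ++ map (p ^ suc a *_) (divisors y) → d ∈ divisors (p ^ suc a * y)
  from {d} d∈ with ∈-++⁻ (divisors (p ^ a * y)) d∈
  ... | inj₁ l = ∈-divisors⁺ (positive (suc a)) (∣-trans (∈-divisors⁻ {n = p ^ a * y} l)
                   (divides p (*-assoc p (p ^ a) y)))
  ... | inj₂ r with e , e∈ , refl ← ∈-map⁻ (p ^ suc a *_) r =
                   ∈-divisors⁺ (positive (suc a)) (*-monoʳ-∣ (p ^ suc a) (∈-divisors⁻ {n = y} e∈))

τ-primePower : ∀ {p} → Prime p → ∀ a {y} → 1 ≤ y → ¬ p ∣ y → τ (p ^ a * y) ≡ suc a * τ y
τ-primePower pp zero    {y} y≥1 p∤y = trans (cong τ (*-identityˡ y)) (sym (*-identityˡ (τ y)))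
τ-primePower pp (suc a) {y} y≥1 p∤y = trans (τ-primePower-suc pp a y≥1 p∤y)
  (trans (cong (_+ τ y) (τ-primePower pp a y≥1 p∤y)) (+-comm (suc a * τ y) (τ y)))

ω-prime* : ∀ {p} → Prime p → ∀ {y} → 1 ≤ y → ¬ p ∣ y → ω (p * y) ≡ suc (ω y)
ω-prime* {p} pp {y} y≥1 p∤y =
  unique-length (primeDivisors-unique (p * y)) (All.tabulate fresh ∷ primeDivisors-unique y) to from
  where
  positive : 1 ≤ p * y
  positive = *-mono-≤ (prime>0 pp) y≥1
  fresh : ∀ {q} → q ∈ primeDivisors y → p ≢ q
  fresh q∈ refl = p∤y (proj₂ (∈-primeDivisors⁻ {n = y} q∈))
  to : ∀ {q} → q ∈ primeDivisors (p * y) → q ∈ p ∷ primeDivisors y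
  to q∈ with ∈-primeDivisors⁻ {n = p * y} q∈
  ... | pq , q∣py with euclidsLemma p y pq q∣py
  ... | inj₁ q∣p = here (prime∣prime⇒≡ pq pp q∣p)
  ... | inj₂ q∣y = there (∈-primeDivisors⁺ y≥1 pq q∣y)
  from : ∀ {q} → q ∈ p ∷ primeDivisors y → q ∈ primeDivisors (p * y)
  from (here refl) = ∈-primeDivisors⁺ positive pp (m∣m*n y)
  from (there q∈) with pq , q∣y ← ∈-primeDivisors⁻ {n = y} q∈ = ∈-primeDivisors⁺ positive pq (∣n⇒∣m*n p q∣y)

ω-bounded : ∀ {n} B → 1 ≤ n → (∀ {p} → Prime p → p ∣ n → p ≤ B) → ω n ≤ B
ω-bounded {n} B n≥1 bound = begin
  ω n ≡⟨ unique-length (primeDivisors-unique n) (Unique.filter⁺ P? (range1-unique B)) to from ⟩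
  length (filter P? (range1 B)) ≤⟨ length-filter P? (range1 B) ⟩
  length (range1 B) ≡⟨ length-range1 B ⟩
  B ∎
  where
  open ≤-Reasoning
  P? = λ p → prime? p ×-dec (p ∣? n)
  to : ∀ {p} → p ∈ primeDivisors n → p ∈ filter P? (range1 B)
  to p∈ with pp , p∣n ← ∈-primeDivisors⁻ {n = n} p∈ =
    ∈-filter⁺ P? (∈-range1⁺ (prime>0 pp) (bound pp p∣n)) (pp , p∣n)
  from : ∀ {p} → p ∈ filter P? (range1 B) → p ∈ primeDivisors n
  from p∈ with pp , p∣n ← proj₂ (∈-filter⁻ P? {xs = range1 B} p∈) = ∈-primeDivisors⁺ n≥1 pp p∣n

primeDivisor : ∀ n → 2 ≤ n → ∃ λ p → Prime p × p ∣ n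
primeDivisor n@(suc _) n≥2 = go (PrimeFactorisation.factors F) (PrimeFactorisation.isFactorisation F)
    (PrimeFactorisation.factorsPrime F)
  where
  F = factorise n
  go : ∀ ps → n ≡ product ps → All Prime ps → ∃ λ p → Prime p × p ∣ n
  go []       eq _        = contradiction (sym eq) (<⇒≢ n≥2)
  go (p ∷ ps) eq (pp ∷ _) = p , pp , divides (product ps) (trans eq (*-comm p (product ps)))

extractPrime : ∀ {p} → Prime p → ∀ x → 1 ≤ x → ∃₂ λ a y → x ≡ p ^ a * y × ¬ p ∣ y × 1 ≤ y
extractPrime {p} pp = <-rec _ step
  where
  step : ∀ x → (∀ {x'} → x' < x → 1 ≤ x' → ∃₂ λ a y → x' ≡ p ^ a * y × ¬ p ∣ y × 1 ≤ y) →
         1 ≤ x → ∃₂ λ a y → x ≡ p ^ a * y × ¬ p ∣ y × 1 ≤ y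
  step x rec x≥1 with p ∣? x
  ... | no p∤x = 0 , x , sym (*-identityˡ x) , p∤x , x≥1
  ... | yes p∣x@(divides c eq) with rec (quotient-< p∣x {{prime⇒nonTrivial pp}} {{>-nonZero x≥1}})
                                   (∣⇒>0 x≥1 (quotient-∣ p∣x))
  ... | a , y , eq' , p∤y , y≥1 = suc a , y ,
    trans eq (trans (cong (_* p) eq') (lem (p ^ a) y p)) , p∤y , y≥1
    where
    lem : ∀ q y p → q * y * p ≡ p * q * y
    lem = solve-∀

^-distribʳ-* : ∀ m n e → (m * n) ^ e ≡ m ^ e * n ^ e
^-distribʳ-* m n zero    = refl
^-distribʳ-* m n (suc e) = trans (cong (m * n *_) (^-distribʳ-* m n e)) (lem m n (m ^ e) (n ^ e))
  where
  lem : ∀ m n x y → m * n * (x * y) ≡ m * x * (n * y)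
  lem = solve-∀

-- Each prime has an exponent divisible by 6 in `x ^ 6`, so it contributes to `τ` a factor congruent
-- to 1 modulo 6. The exponent 6 serves the moduli 2 and 3 at once.
τ-sixthPower : ∀ x → 1 ≤ x → ∃ λ w → τ (x ^ 6) ≡ 1 + 6 * w
τ-sixthPower = <-rec _ step
  where
  step : ∀ x → (∀ {y} → y < x → 1 ≤ y → ∃ λ w → τ (y ^ 6) ≡ 1 + 6 * w) →
         1 ≤ x → ∃ λ w → τ (x ^ 6) ≡ 1 + 6 * w
  step 1 rec _ = 0 , refl
  step x@(suc (suc _)) rec x≥1 with primeDivisor x (s≤s (s≤s z≤n))
  ... | p , pp , p∣x with extractPrime pp x x≥1
  ... | zero  , y , eq , p∤y , y≥1 = contradiction (subst (p ∣_) (trans eq (*-identityˡ y)) p∣x) p∤y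
  ... | suc a , y , eq , p∤y , y≥1 with rec y<x y≥1
    where
    instance _ = >-nonZero y≥1
    y<x : y < x
    y<x = subst (y <_) (sym eq) (m<n*m {n = p ^ suc a} (subst (1 <_) refl
            (^-monoʳ-< p (nonTrivial⇒n>1 p {{prime⇒nonTrivial pp}}) {0} {suc a} (s≤s z≤n))))
      where
      m<n*m : ∀ {n} → 1 < n → y < n * y
      m<n*m {n} 1<n = subst (_< n * y) (*-identityˡ y) (*-monoˡ-< y 1<n)
  ... | w , eqw = w + suc a + suc a * (6 * w) , (begin
      τ (x ^ 6)                       ≡⟨ cong (λ z → τ (z ^ 6)) eq ⟩
      τ ((p ^ suc a * y) ^ 6)         ≡⟨ cong τ (^-distribʳ-* (p ^ suc a) y 6) ⟩
      τ ((p ^ suc a) ^ 6 * y ^ 6)     ≡⟨ cong (λ z → τ (z * y ^ 6)) (^-*-assoc p (suc a) 6) ⟩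
      τ (p ^ (suc a * 6) * y ^ 6)     ≡⟨ τ-primePower pp (suc a * 6) (m^n>0 y 6) (p∤y ∘ prime∣^⇒prime∣ pp y 6) ⟩
      suc (suc a * 6) * τ (y ^ 6)     ≡⟨ cong (suc (suc a * 6) *_) eqw ⟩
      suc (suc a * 6) * (1 + 6 * w)   ≡⟨ lem (suc a) w ⟩
      1 + 6 * (w + suc a + suc a * (6 * w)) ∎)
    where
    open ≡-Reasoning
    instance _ = >-nonZero y≥1
    lem : ∀ s w → suc (s * 6) * (1 + 6 * w) ≡ 1 + 6 * (w + s + s * (6 * w))
    lem = solve-∀

-- Leading digits of smooth numbers

-- A discrete intermediate value principle, used to find the exponent at which a sequence of powers
-- passes a bound.
crossing : ∀ {T : ℕ → Set} → (∀ s → Dec (T s)) → ¬ T 0 → ∀ s → T s → ∃ λ j → ¬ T j × T (suc j)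
crossing T? ¬T0 zero    T0 = contradiction T0 ¬T0
crossing T? ¬T0 (suc s) Ts with T? s
... | yes t = crossing T? ¬T0 s t
... | no ¬t = s , ¬t , Ts

n<m^n : ∀ {m} → 2 ≤ m → ∀ n → n < m ^ n
n<m^n m≥2 zero    = s≤s z≤n
n<m^n {m} m≥2 (suc n) = begin-strict
  suc n          <⟨ s<s (n<m^n m≥2 n) ⟩
  1 + m ^ n      ≤⟨ +-monoˡ-≤ (m ^ n) (m^n>0 m n) ⟩
  m ^ n + m ^ n  ≡⟨ cong (m ^ n +_) (+-identityʳ (m ^ n)) ⟨
  2 * m ^ n      ≤⟨ *-monoˡ-≤ (m ^ n) m≥2 ⟩
  m * m ^ n      ∎
  where
  open ≤-Reasoning
  instance _ = >-nonZero (≤-trans (s≤s z≤n) m≥2)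

bracket : ∀ {K} → 2 ≤ K → ∀ x → 1 ≤ x → ∃ λ b → K ^ b ≤ x × x < K ^ suc b
bracket {K} K≥2 x x≥1 with crossing (λ s → x <? K ^ s) (≤⇒≯ x≥1) x (n<m^n K≥2 x)
... | b , x≮ , x< = b , ≮⇒≥ x≮ , x<

-- Bernoulli's inequality `(U / W) ^ s ≥ 1 + s / W`, cleared of denominators; it rests on
-- `U / W ≥ 1 + 1 / W`.
bernoulli : ∀ {U W} → W < U → ∀ s → (W + s) * W ^ s ≤ W * U ^ s
bernoulli {U} {W} W<U zero = ≤-reflexive (cong (_* 1) (+-identityʳ W))
bernoulli {U} {W} W<U (suc s) = begin
  (W + suc s) * (W * W ^ s)                ≤⟨ m≤m+n _ (s * W ^ s) ⟩
  (W + suc s) * (W * W ^ s) + s * W ^ s    ≡⟨ lem W s (W ^ s) ⟩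
  (1 + W) * ((W + s) * W ^ s)              ≤⟨ *-mono-≤ W<U (bernoulli W<U s) ⟩
  U * (W * U ^ s)                          ≡⟨ lem' U W (U ^ s) ⟩
  W * (U * U ^ s)                          ∎
  where
  open ≤-Reasoning
  lem : ∀ W s x → (W + suc s) * (W * x) + s * x ≡ (1 + W) * ((W + s) * x)
  lem = solve-∀
  lem' : ∀ U W x → U * (W * x) ≡ W * (U * x)
  lem' = solve-∀

unbounded : ∀ {U W} → 1 ≤ W → W < U → ∀ t → ∃ λ s → suc t * W ^ s ≤ U ^ s
unbounded {U} {W} W≥1 W<U t = W * t , *-cancelˡ-≤ W {{>-nonZero W≥1}}
  (≤-trans (≤-reflexive (lem W t (W ^ (W * t)))) (bernoulli W<U (W * t)))
  where
  lem : ∀ W t x → W * (suc t * x) ≡ (W + W * t) * x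
  lem = solve-∀

-- The powers of `U / W` start at 1 and grow without bound. Just before they reach `n + 1` they are
-- at least `n`, because one step multiplies by at most `(n + 1) / n`.
climb : ∀ {U W} n → 1 ≤ n → 0 < W → W < U → n * U ≤ suc n * W →
  ∃ λ j → n * W ^ j ≤ U ^ j × U ^ j < suc n * W ^ j
climb {U} {W} n n≥1 W>0 W<U step with unbounded W>0 W<U n
... | s , big with crossing (λ s → suc n * W ^ s ≤? U ^ s)
                     (λ le → <⇒≱ n≥1 (≤-pred (subst (_≤ 1) (*-identityʳ (suc n)) le))) s big
... | j , ¬Tj , Tj+1 = j , *-cancelˡ-≤ U {{>-nonZero (<-trans W>0 W<U)}} (begin
    U * (n * W ^ j)        ≡⟨ lem n U (W ^ j) ⟩
    n * U * W ^ j          ≤⟨ *-monoˡ-≤ (W ^ j) step ⟩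
    suc n * W * W ^ j      ≡⟨ *-assoc (suc n) W (W ^ j) ⟩
    suc n * (W * W ^ j)    ≤⟨ Tj+1 ⟩
    U * U ^ j              ∎) , ≰⇒> ¬Tj
  where
  open ≤-Reasoning
  lem : ∀ n U x → U * (n * x) ≡ n * U * x
  lem = solve-∀

-- The mirror image of `climb`: `A * (U / W) ^ j` starts at or above `n + 1` and shrinks. The first
-- value after crossing below `n + 1` is still at least `n`, because one step multiplies by at least
-- `n / (n + 1)`.
descend : ∀ {U W} A n → suc n ≤ A → 0 < U → U < W → n * W ≤ suc n * U →
  ∃ λ j → n * W ^ j ≤ A * U ^ j × A * U ^ j < suc n * W ^ j
descend {U} {W} A n n<A U>0 U<W step with unbounded U>0 U<W A
... | s , big with crossing (λ s → A * U ^ s <? suc n * W ^ s) (≤⇒≯ (*-monoˡ-≤ 1 n<A)) s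
                     (<-≤-trans (*-monoˡ-< (U ^ s) {{m^n≢0 U s {{>-nonZero U>0}}}} (n<1+n A))
                       (≤-trans big (m≤n*m (W ^ s) (suc n))))
... | j , ¬Tj , Tj+1 = suc j , (begin
    n * (W * W ^ j)        ≡⟨ *-assoc n W (W ^ j) ⟨
    n * W * W ^ j          ≤⟨ *-monoˡ-≤ (W ^ j) step ⟩
    suc n * U * W ^ j      ≡⟨ lem (suc n) U (W ^ j) ⟩
    U * (suc n * W ^ j)    ≤⟨ *-monoʳ-≤ U (≮⇒≥ ¬Tj) ⟩
    U * (A * U ^ j)        ≡⟨ lem' A U (U ^ j) ⟩
    A * (U * U ^ j)        ∎) , Tj+1
  where
  open ≤-Reasoning
  lem : ∀ n U x → n * U * x ≡ U * (n * x)
  lem = solve-∀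
  lem' : ∀ x U y → U * (x * y) ≡ x * (U * y)
  lem' = solve-∀

-- In fractions, `L * (p' / k') < F + 1 ≤ L * (p / k) + 1 ≤ (L + 1) * (p /
-- k)`, the last step because `p / k ≥ 1`.
ratioBound : ∀ L {F p p' k k'} → .{{NonZero k}} → F * k ≤ L * p → k ≤ p → L * p' < suc F * k' →
  L * (p' * k) < suc L * (p * k')
ratioBound L {F} {p} {p'} {k} {k'} lo k≤p hi = begin-strict
  L * (p' * k)             ≡⟨ *-assoc L p' k ⟨
  L * p' * k               <⟨ *-monoˡ-< k hi ⟩
  suc F * k' * k           ≡⟨ lem F k k' ⟩
  (F * k + k) * k'         ≤⟨ *-monoˡ-≤ k' (+-mono-≤ lo k≤p) ⟩
  (L * p + p) * k'         ≡⟨ lem' L p k' ⟩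
  suc L * (p * k')         ∎
  where
  open ≤-Reasoning
  lem : ∀ F k k' → suc F * k' * k ≡ (F * k + k) * k'
  lem = solve-∀
  lem' : ∀ L p k → (L * p + p) * k ≡ suc L * (p * k)
  lem' = solve-∀

-- The hypothesis `independent` expresses that `log P / log K` is irrational.
module _ {K P : ℕ} (K≥2 : 2 ≤ K) (P≥1 : 1 ≤ P) (independent : ∀ d e → 1 ≤ d → P ^ d ≢ K ^ e) where

  private instance
    K≢0 : NonZero K
    K≢0 = >-nonZero (≤-trans (s≤s z≤n) K≥2)
    P≢0 : NonZero P
    P≢0 = >-nonZero P≥1

  private
    exponent : ℕ → ℕ
    exponent i = proj₁ (bracket K≥2 (P ^ i) (m^n>0 P i))

    exponent-≤ : ∀ i → K ^ exponent i ≤ P ^ i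
    exponent-≤ i = proj₁ (proj₂ (bracket K≥2 (P ^ i) (m^n>0 P i)))

    exponent-> : ∀ i → P ^ i < K ^ suc (exponent i)
    exponent-> i = proj₂ (proj₂ (bracket K≥2 (P ^ i) (m^n>0 P i)))

    module Mantissa (L : ℕ) (L≥1 : 1 ≤ L) where

      mantissa : ℕ → ℕ
      mantissa i = _/_ (L * P ^ i) (K ^ exponent i) {{m^n≢0 K (exponent i)}}

      mantissa-< : ∀ i → mantissa i < L * K
      mantissa-< i = m<n*o⇒m/o<n {{m^n≢0 K (exponent i)}} (subst (L * P ^ i <_) (sym (*-assoc L K _))
                       (*-monoʳ-< L {{>-nonZero L≥1}} (exponent-> i)))

      mantissa-lower : ∀ i → mantissa i * K ^ exponent i ≤ L * P ^ i
      mantissa-lower i = m/n*n≤m (L * P ^ i) (K ^ exponent i) {{m^n≢0 K (exponent i)}}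

      mantissa-upper : ∀ i → L * P ^ i < suc (mantissa i) * K ^ exponent i
      mantissa-upper i = subst (_< suc (mantissa i) * K ^ exponent i)
        (sym (m≡m%n+[m/n]*n (L * P ^ i) (K ^ exponent i) {{m^n≢0 K (exponent i)}}))
        (+-monoˡ-< (mantissa i * K ^ exponent i)
          (m%n<n (L * P ^ i) (K ^ exponent i) {{m^n≢0 K (exponent i)}}))

  -- Pigeonhole on the parts ⌊L P^i / K^(b i)⌋ < L K of the mantissas P^i / K^(b i) ∈ [1, K).
  closePowers : ∀ L → 1 ≤ L → ∃₂ λ d e → ∃ λ e' → P ^ d * K ^ e ≢ K ^ e' ×
    L * (P ^ d * K ^ e) < suc L * K ^ e' × L * K ^ e' < suc L * (P ^ d * K ^ e)
  closePowers L L≥1 with pigeonhole (n<1+n (L * K)) (λ i → fromℕ< (mantissa-< (toℕ i)))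
    where open Mantissa L L≥1
  -- The quotient of the mantissas of `P ^ j` and `P ^ i` is `P ^ d * K ^ e / K ^ e'`. As their
  -- integer parts after scaling by `L` agree, it is within a factor `(L + 1) / L` of 1.
  ... | i' , j' , i<j , eq = d , e , e' , distinct , close₁ , close₂
    where
    i = toℕ i'
    j = toℕ j'
    d = j ∸ i
    e = exponent i
    e' = exponent j
    open Mantissa L L≥1
    same : mantissa i ≡ mantissa j
    same = trans (sym (toℕ-fromℕ< _)) (trans (cong toℕ eq) (toℕ-fromℕ< _))
    P^j : P ^ j ≡ P ^ i * P ^ d
    P^j = trans (cong (P ^_) (sym (m+[n∸m]≡n (<⇒≤ i<j)))) (^-distribˡ-+-* P i d)
    lem₁ : ∀ L x y z → L * (x * y * z) ≡ x * (L * (y * z))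
    lem₁ = solve-∀
    lem₂ : ∀ L x z → L * (x * z) ≡ x * (L * z)
    lem₂ = solve-∀
    close₁ : L * (P ^ d * K ^ e) < suc L * K ^ e'
    close₁ = *-cancelˡ-< (P ^ i) _ _ (subst₂ _<_
      (trans (cong (λ z → L * (z * K ^ e)) P^j) (lem₁ L (P ^ i) (P ^ d) (K ^ e)))
      (lem₂ (suc L) (P ^ i) (K ^ e'))
      (ratioBound L {mantissa i} {P ^ i} {P ^ j} {K ^ e} {K ^ e'} {{m^n≢0 K e}} (mantissa-lower i) (exponent-≤ i)
        (subst (λ z → L * P ^ j < suc z * K ^ e') (sym same) (mantissa-upper j))))
    close₂ : L * K ^ e' < suc L * (P ^ d * K ^ e)
    close₂ = *-cancelˡ-< (P ^ i) _ _ (subst₂ _<_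
      (lem₂ L (P ^ i) (K ^ e'))
      (trans (cong (λ z → suc L * (z * K ^ e)) P^j) (lem₁ (suc L) (P ^ i) (P ^ d) (K ^ e)))
      (ratioBound L {mantissa j} {P ^ j} {P ^ i} {K ^ e'} {K ^ e} {{m^n≢0 K e'}} (mantissa-lower j) (exponent-≤ j)
        (subst (λ z → L * P ^ i < suc z * K ^ e) same (mantissa-upper i))))
    distinct : P ^ d * K ^ e ≢ K ^ e'
    distinct eq with e ≤? e'
    ... | yes e≤e' = independent d (e' ∸ e) (m<n⇒0<n∸m i<j) (*-cancelʳ-≡ _ _ (K ^ e) {{m^n≢0 K e}}
            (trans eq (trans (cong (K ^_) (sym (m∸n+n≡m e≤e'))) (^-distribˡ-+-* K (e' ∸ e) e))))
    ... | no e≰e' = <-irrefl (sym eq) (<-≤-trans (^-monoʳ-< K K≥2 (≰⇒> e≰e'))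
            (m≤n*m (K ^ e) (P ^ d) {{m^n≢0 P d}}))

  LeadingDigits : ℕ → Set
  LeadingDigits n = ∃₂ λ a C → ∃ λ l → K ^ l * n ≤ P ^ a * K ^ C × P ^ a * K ^ C < K ^ l * suc n

  private
    powerOfRatio : ∀ d e e' n C →
      (∃ λ j → n * (K ^ e') ^ j ≤ K ^ C * (P ^ d * K ^ e) ^ j × K ^ C * (P ^ d * K ^ e) ^ j < suc n * (K ^ e') ^ j) →
      LeadingDigits n
    powerOfRatio d e e' n C (j , lo , hi) = d * j , C + e * j , e' * j ,
      subst₂ _≤_ (lhs n) rhs lo , subst₂ _<_ rhs (lhs (suc n)) hi
      where
      lhs : ∀ n → n * (K ^ e') ^ j ≡ K ^ (e' * j) * n
      lhs n = trans (*-comm n ((K ^ e') ^ j)) (cong (_* n) (^-*-assoc K e' j))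
      lem : ∀ x y z → x * (y * z) ≡ y * (x * z)
      lem = solve-∀
      U^ : (P ^ d * K ^ e) ^ j ≡ P ^ (d * j) * K ^ (e * j)
      U^ = trans (^-distribʳ-* (P ^ d) (K ^ e) j) (cong₂ _*_ (^-*-assoc P d j) (^-*-assoc K e j))
      rhs : K ^ C * (P ^ d * K ^ e) ^ j ≡ P ^ (d * j) * K ^ (C + e * j)
      rhs = trans (cong (K ^ C *_) U^) (trans (lem (K ^ C) (P ^ (d * j)) (K ^ (e * j)))
              (cong (P ^ (d * j) *_) (sym (^-distribˡ-+-* K C (e * j)))))

  -- The powers of a ratio U/W = P^d K^e / K^e' with 1 ≠ U/W ∈ (n/(n+1), (n+1)/n), multiplied by a
  -- power of K when U < W, move in steps too small to jump over [n, n+1).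
  leadingDigits : ∀ n → 1 ≤ n → LeadingDigits n
  leadingDigits n n≥1 = fromClose (closePowers n n≥1)
    where
    fromClose : (∃₂ λ d e → ∃ λ e' → P ^ d * K ^ e ≢ K ^ e' ×
      n * (P ^ d * K ^ e) < suc n * K ^ e' × n * K ^ e' < suc n * (P ^ d * K ^ e)) → LeadingDigits n
    fromClose (d , e , e' , U≢W , nU< , nW<) = split (<-cmp (P ^ d * K ^ e) (K ^ e'))
      where
      scale : ∀ {U W} → (∃ λ j → n * W ^ j ≤ U ^ j × U ^ j < suc n * W ^ j) →
        ∃ λ j → n * W ^ j ≤ 1 * U ^ j × 1 * U ^ j < suc n * W ^ j
      scale {U} {W} (j , lo , hi) = j , ≤-trans lo (≤-reflexive (sym (*-identityˡ (U ^ j)))) ,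
        ≤-<-trans (≤-reflexive (*-identityˡ (U ^ j))) hi
      split : Tri (P ^ d * K ^ e < K ^ e') (P ^ d * K ^ e ≡ K ^ e') (P ^ d * K ^ e > K ^ e') → LeadingDigits n
      split (tri≈ _ U≡W _) = contradiction U≡W U≢W
      split (tri> _ _ W<U) = powerOfRatio d e e' n 0
        (scale {P ^ d * K ^ e} {K ^ e'} (climb n n≥1 (m^n>0 K e') W<U (<⇒≤ nU<)))
      split (tri< U<W _ _) = powerOfRatio d e e' n (suc n)
        -- The starting value `K ^ suc n` is a power of `K` above `n + 1`.
        (descend (K ^ suc n) n (<⇒≤ (n<m^n K≥2 (suc n)))
          (*-mono-≤ (m^n>0 P d) (m^n>0 K e)) U<W (<⇒≤ nW<))

-- Triangular matrices of bounded rank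

linComb-punchIn : ∀ m (h : Fin (suc m)) c g n →
  linComb (suc m) c g n ≡ c h ℤ.* g h n ℤ.+ linComb m (c ∘ punchIn h) (g ∘ punchIn h) n
linComb-punchIn m       Fin.zero    c g n = refl
linComb-punchIn (suc m) (Fin.suc h) c g n =
  trans (cong (λ z → c Fin.zero ℤ.* g Fin.zero n ℤ.+ z) (linComb-punchIn m h (c ∘ Fin.suc) (g ∘ Fin.suc) n))
        (lem (c Fin.zero ℤ.* g Fin.zero n) (c (Fin.suc h) ℤ.* g (Fin.suc h) n) _)
  where
  lem : ∀ x y z → x ℤ.+ (y ℤ.+ z) ≡ y ℤ.+ (x ℤ.+ z)
  lem = solveℤ-∀

∣-linComb : ∀ {d} m c g n → (∀ i → d ∣ℤ g i n) → d ∣ℤ linComb m c g n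
∣-linComb {d} zero c g n h = ∣ᵤ⇒∣ (ℤ.∣ d ∣ ∣0)
∣-linComb (suc m) c g n h =
  ℤ.∣m∣n⇒∣m+n (ℤ.∣n⇒∣m*n (c Fin.zero) (h Fin.zero)) (∣-linComb m _ (g ∘ Fin.suc) n (h ∘ Fin.suc))

-- A 2×2 minor is linear in the row `g i`, so combining minors of the generators gives the minor of
-- the combination.
linComb-minor : ∀ m c g x (y : ℕ → ℤ) n n' →
  linComb m c (λ i j → x ℤ.* g i j ℤ.- y j ℤ.* g i n) n'
    ≡ x ℤ.* linComb m c g n' ℤ.- y n' ℤ.* linComb m c g n
linComb-minor zero c g x y n n' = lem x (y n')
  where
  lem : ∀ x y → pos 0 ≡ x ℤ.* pos 0 ℤ.- y ℤ.* pos 0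
  lem = solveℤ-∀
linComb-minor (suc m) c g x y n n' =
  trans (cong (λ z → c Fin.zero ℤ.* (x ℤ.* g Fin.zero n' ℤ.- y n' ℤ.* g Fin.zero n) ℤ.+ z)
              (linComb-minor m (c ∘ Fin.suc) (g ∘ Fin.suc) x y n n'))
        (lem (c Fin.zero) x (y n') (g Fin.zero n) (g Fin.zero n') _ _)
  where
  lem : ∀ c x y g g' s s' → c ℤ.* (x ℤ.* g' ℤ.- y ℤ.* g) ℤ.+ (x ℤ.* s' ℤ.- y ℤ.* s)
        ≡ x ℤ.* (c ℤ.* g' ℤ.+ s') ℤ.- y ℤ.* (c ℤ.* g ℤ.+ s)
  lem = solveℤ-∀

^-monoʳ-∣ : ∀ q {a b} → a ≤ b → q ^ a ∣ q ^ b
^-monoʳ-∣ q {a} {b} a≤b = divides (q ^ (b ∸ a))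
  (trans (cong (q ^_) (sym (m∸n+n≡m a≤b))) (^-distribˡ-+-* q (b ∸ a) a))

primePower-∤* : ∀ {q} → Prime q → ∀ b {x y} →
  ¬ pos (q ^ b) ∣ℤ x → ¬ pos (q ^ b) ∣ℤ y → ¬ pos (q ^ (b + b)) ∣ℤ x ℤ.* y
primePower-∤* {q} pq b {x} {y} ∤x ∤y h
  with primePower-∣* pq b b ℤ.∣ x ∣ ℤ.∣ y ∣ (subst (q ^ (b + b) ∣_) (abs-* x y) (∣⇒∣ᵤ h))
... | inj₁ r = ∤x (∣ᵤ⇒∣ (∣-trans (n∣m*n q) r))
... | inj₂ r = ∤y (∣ᵤ⇒∣ r)

-- Column elimination: the 2×2 minors against the first entry keep the pattern, with b doubled,
-- and need one generating sequence less.
noTriangle : ∀ {R : Set} {q} → Prime q → ∀ m (c : R → Fin m → ℤ) g b V → b * 2 ^ m ≤ V →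
  (xs : List (R × ℕ)) → length xs ≡ suc m →
  All (λ (r , n) → ¬ pos (q ^ b) ∣ℤ linComb m (c r) g n) xs →
  AllPairs (λ (_ , n) (r , _) → pos (q ^ V) ∣ℤ linComb m (c r) g n) xs → ⊥
-- Without generators every entry is 0, which no diagonal entry can be.
noTriangle {q = q} pq zero c g b V _ (_ ∷ []) _ (d ∷ []) _ = d (∣ᵤ⇒∣ ((q ^ b) ∣0))
noTriangle {R} {q} pq (suc m) c g b V b≤V ((r , n) ∷ xs) len (d ∷ ds) (o ∷ os)
  -- The first diagonal entry combines the values `g i n`, so one of these, `g h n`, is not
  -- divisible by `q ^ b`; it is the pivot.
  with ¬∀⟶∃¬ (suc m) (λ i → pos (q ^ b) ∣ℤ g i n) (λ i → pos (q ^ b) ∣ℤ? g i n)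
             (λ all → d (∣-linComb (suc m) (c r) g n all))
... | h , ∤gh = noTriangle pq m (λ r → c r ∘ punchIn h) g' (b + b) V 2b≤V xs (suc-injective len)
        (All.zipWith (λ { {r' , n'} → diagonal r' n' }) (o , ds))
        (offDiagonals xs o os)
  where
  minor : Fin (suc m) → ℕ → ℤ
  minor i j = g h n ℤ.* g i j ℤ.- g h j ℤ.* g i n
  g' : Fin m → ℕ → ℤ
  g' = minor ∘ punchIn h
  2b≤V : (b + b) * 2 ^ m ≤ V
  2b≤V = ≤-trans (≤-reflexive (lem b (2 ^ m))) b≤V
    where
    lem : ∀ b x → (b + b) * x ≡ b * (2 * x)
    lem = solve-∀
  -- The minor of `g h` with itself vanishes, so dropping the index `h` does not change the
  -- combination.
  expand : ∀ r' j → linComb m (c r' ∘ punchIn h) g' j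
             ≡ g h n ℤ.* linComb (suc m) (c r') g j ℤ.- g h j ℤ.* linComb (suc m) (c r') g n
  expand r' j = begin
    S ≡⟨ lem (c r' h) (g h n) (g h j) S ⟨
    c r' h ℤ.* minor h j ℤ.+ S ≡⟨ linComb-punchIn m h (c r') minor j ⟨
    linComb (suc m) (c r') minor j ≡⟨ linComb-minor (suc m) (c r') g (g h n) (g h) n j ⟩
    _ ∎
    where
    open ≡-Reasoning
    S = linComb m (c r' ∘ punchIn h) g' j
    lem : ∀ c x y s → c ℤ.* (x ℤ.* y ℤ.- y ℤ.* x) ℤ.+ s ≡ s
    lem = solveℤ-∀
  -- Since `b + b ≤ V`, modulo `q ^ (b + b)` only the pivot times the old diagonal entry remains.
  diagonal : ∀ r' n' → pos (q ^ V) ∣ℤ linComb (suc m) (c r') g n × ¬ pos (q ^ b) ∣ℤ linComb (suc m) (c r') g n' →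
             ¬ pos (q ^ (b + b)) ∣ℤ linComb m (c r' ∘ punchIn h) g' n'
  diagonal r' n' (∣n , ∤n') ∣S = primePower-∤* pq b ∤gh ∤n'
    (subst (pos (q ^ (b + b)) ∣ℤ_) (lem _ _)
      (ℤ.∣m∣n⇒∣m+n (subst (pos (q ^ (b + b)) ∣ℤ_) (expand r' n') ∣S)
        (ℤ.∣n⇒∣m*n (g h n') (ℤ.∣-trans (∣ᵤ⇒∣ (^-monoʳ-∣ q b+b≤V)) ∣n))))
    where
    b+b≤V : b + b ≤ V
    b+b≤V = ≤-trans (m≤m*n (b + b) (2 ^ m) {{m^n≢0 2 m}}) 2b≤V
    lem : ∀ x y → (x ℤ.- y) ℤ.+ y ≡ x
    lem = solveℤ-∀
  offDiagonal : ∀ {r' j} → pos (q ^ V) ∣ℤ linComb (suc m) (c r') g n → pos (q ^ V) ∣ℤ linComb (suc m) (c r') g j →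
                pos (q ^ V) ∣ℤ linComb m (c r' ∘ punchIn h) g' j
  offDiagonal {r'} {j} ∣n ∣j = subst (pos (q ^ V) ∣ℤ_) (sym (expand r' j))
    (ℤ.∣m∣n⇒∣m-n (ℤ.∣n⇒∣m*n (g h n) ∣j) (ℤ.∣n⇒∣m*n (g h j) ∣n))
  offDiagonals : ∀ xs → All (λ (r' , _) → pos (q ^ V) ∣ℤ linComb (suc m) (c r') g n) xs →
    AllPairs (λ (_ , j) (r' , _) → pos (q ^ V) ∣ℤ linComb (suc m) (c r') g j) xs →
    AllPairs (λ (_ , j) (r' , _) → pos (q ^ V) ∣ℤ linComb m (c r' ∘ punchIn h) g' j) xs
  offDiagonals []       _       _          = []
  offDiagonals (_ ∷ xs) (_ ∷ o) (os ∷ oss) =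
    All.zipWith (λ { {_ , _} (a , b) → offDiagonal a b }) (o , os) ∷ offDiagonals xs o oss

-- Congruences

coprime-factorʳ : ∀ {m n o} → n ∣ o → Coprime m o → Coprime m n
coprime-factorʳ n∣o c (d∣m , d∣n) = c (d∣m , ∣-trans d∣n n∣o)

coprime-*ʳ : ∀ {m n o} → Coprime m n → Coprime m o → Coprime m (n * o)
coprime-*ʳ c c' (d∣m , d∣no) = c' (d∣m , coprime-divisor (λ (e∣d , e∣n) → c (∣-trans e∣d d∣m , e∣n)) d∣no)

coprime-^ʳ : ∀ {m n} → Coprime m n → ∀ e → Coprime m (n ^ e)
coprime-^ʳ c zero    = Coprime.sym (Coprime.1-coprimeTo _)
coprime-^ʳ c (suc e) = coprime-*ʳ c (coprime-^ʳ c e)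

prime∤⇒coprime : ∀ {p n} → Prime p → ¬ p ∣ n → Coprime n p
prime∤⇒coprime pp p∤n (d∣n , d∣p) with prime⇒irreducible pp d∣p
... | inj₁ d≡1  = d≡1
... | inj₂ refl = contradiction d∣n p∤n

inverse : ∀ a m → 1 ≤ a → Coprime a m → ∃₂ λ u v → a * u ≡ 1 + m * v
inverse a m a≥1 c with coprime-Bézout c
... | Bézout.+- x y eq = x , y , trans (*-comm a x) (trans (sym eq) (cong suc (*-comm y m)))
-- The identity reads `1 ≡ y * m`, which forces `m` to be 1.
... | Bézout.-+ zero y eq with m*n≡1⇒n≡1 y m (sym eq)
...   | refl = 1 , a ∸ 1 , trans (*-identityʳ a) (trans (sym (m+[n∸m]≡n a≥1)) (cong suc (sym (*-identityˡ (a ∸ 1)))))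
-- Here `suc x * a` is congruent to -1 modulo `m`; its square is congruent to 1 and supplies the
-- inverse.
inverse a m a≥1 c | Bézout.-+ (suc x) y eq = square (suc x * a) refl
  where
  square : ∀ t → suc x * a ≡ t → ∃₂ λ u v → a * u ≡ 1 + m * v
  square zero    eq₀ = contradiction (sym eq₀) (<⇒≢ (*-mono-≤ (s≤s (z≤n {x})) a≥1))
  square (suc t) eq₁ = suc x * (a * suc x) , t * y , (begin
    a * (suc x * (a * suc x))     ≡⟨ lem a (suc x) ⟩
    (suc x * a) * (suc x * a)     ≡⟨ cong (λ z → z * z) eq₁ ⟩
    suc t * suc t                 ≡⟨ lem' t ⟩
    1 + t * (1 + suc t)           ≡⟨ cong (λ z → 1 + t * suc z) eq₁ ⟨
    1 + t * (1 + suc x * a)       ≡⟨ cong (λ z → 1 + t * z) eq ⟩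
    1 + t * (y * m)               ≡⟨ lem'' t y m ⟩
    1 + m * (t * y)               ∎)
    where
    open ≡-Reasoning
    lem : ∀ a x → a * (x * (a * x)) ≡ (x * a) * (x * a)
    lem = solve-∀
    lem' : ∀ t → suc t * suc t ≡ 1 + t * (1 + suc t)
    lem' = solve-∀
    lem'' : ∀ t y m → 1 + t * (y * m) ≡ 1 + m * (t * y)
    lem'' = solve-∀

solveCongruence : ∀ a r Q m → 1 ≤ a → 1 ≤ m → Coprime a m → ∃₂ λ z y → a * z + r ≡ Q + m * y
solveCongruence a r Q m@(suc m') a≥1 _ c with inverse a m a≥1 c
-- As `m'` is `m - 1`, the term `r * m'` stands for `-r` modulo `m`.
... | u , v , eq = u * (Q + r * m') , r + v * (Q + r * m') , (begin
    a * (u * (Q + r * m')) + r           ≡⟨ cong (_+ r) (*-assoc a u _) ⟨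
    a * u * (Q + r * m') + r             ≡⟨ cong (λ z → z * (Q + r * m') + r) eq ⟩
    (1 + m * v) * (Q + r * m') + r       ≡⟨ lem m' v Q r ⟩
    Q + m * (r + v * (Q + r * m'))       ∎)
  where
  open ≡-Reasoning
  lem : ∀ m' v Q r → (1 + suc m' * v) * (Q + r * m') + r ≡ Q + suc m' * (r + v * (Q + r * m'))
  lem = solve-∀

-- For `d'` positive, a prime divisor of `k` would also divide `suc k`; for `d'` zero the left side
-- exceeds 1.
suc-independent : ∀ {k} → 2 ≤ k → ∀ e d d' → 1 ≤ d → (suc k ^ suc e) ^ d ≢ (k ^ suc e) ^ d'
suc-independent {k} k≥2 e d zero d≥1 eq = contradiction (sym eq)
  (<⇒≢ (^-monoʳ-< (suc k ^ suc e) (^-monoʳ-< (suc k) (≤-trans k≥2 (n≤1+n k)) {0} {suc e} (s≤s z≤n)) {0} d≥1))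
suc-independent {k} k≥2 e d (suc d') _ eq = let p , pp , p∣k = primeDivisor k k≥2 in
  prime∤1 pp (∣m+n∣m⇒∣n (subst (p ∣_) (+-comm 1 k)
    (prime∣^⇒prime∣ pp (suc k) (suc e) (prime∣^⇒prime∣ pp (suc k ^ suc e) d
      (subst (p ∣_) (sym eq) (∣m⇒∣m*n ((k ^ suc e) ^ d') (∣m⇒∣m*n (k ^ e) p∣k)))))) p∣k)

-- `leadingDigits` is applied to the bases `k ^ suc e` and `suc k ^ suc e`, so that the number found
-- is itself a perfect power with exponent `suc e`.
leadingPower : ∀ {k} → 2 ≤ k → ∀ e n → 1 ≤ n → ∃₂ λ a C → ∃ λ l →
  k ^ l * n ≤ (suc k ^ a * k ^ C) ^ suc e × (suc k ^ a * k ^ C) ^ suc e < k ^ l * suc n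
leadingPower {k} k≥2 e n n≥1 = convert (leadingDigits {k ^ suc e} {suc k ^ suc e}
    (≤-trans k≥2 (m≤m*n k (k ^ e) {{m^n≢0 k e}})) (m^n>0 (suc k) (suc e)) (suc-independent k≥2 e) n n≥1)
  where
  instance _ = >-nonZero (≤-trans (s≤s z≤n) k≥2)
  swap : ∀ m a → (m ^ suc e) ^ a ≡ (m ^ a) ^ suc e
  swap m a = trans (^-*-assoc m (suc e) a) (trans (cong (m ^_) (*-comm (suc e) a)) (sym (^-*-assoc m a (suc e))))
  convert : (∃₂ λ a C → ∃ λ l → (k ^ suc e) ^ l * n ≤ (suc k ^ suc e) ^ a * (k ^ suc e) ^ C
              × (suc k ^ suc e) ^ a * (k ^ suc e) ^ C < (k ^ suc e) ^ l * suc n) →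
    ∃₂ λ a C → ∃ λ l →
      k ^ l * n ≤ (suc k ^ a * k ^ C) ^ suc e × (suc k ^ a * k ^ C) ^ suc e < k ^ l * suc n
  convert (a , C , l , lo , hi) = a , C , suc e * l ,
    subst₂ _≤_ (cong (_* n) (^-*-assoc k (suc e) l)) power lo ,
    subst₂ _<_ power (cong (_* suc n) (^-*-assoc k (suc e) l)) hi
    where
    power : (suc k ^ suc e) ^ a * (k ^ suc e) ^ C ≡ (suc k ^ a * k ^ C) ^ suc e
    power = trans (cong₂ _*_ (swap (suc k) a) (swap k C)) (sym (^-distribʳ-* (suc k ^ a) (k ^ C) (suc e)))

-- The triangular array

seq₁-positive : ∀ f {n} → 1 ≤ n → seq₁ f n ≡ pos (f n)
seq₁-positive f {suc n} _ = refl

module _ {k : ℕ} (k≥2 : 2 ≤ k) {q : ℕ} (pq : Prime q) (f : ℕ → ℕ)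
  (f-prime* : ∀ {p} → Prime p → ∀ {x} → 1 ≤ x → ¬ p ∣ x → q * f x ∣ f (p * x))
  (b : ℕ) (f-smooth : ∀ a C → ¬ q ^ b ∣ f ((suc k ^ a * k ^ C) ^ 6))
  where

  private instance
    k≢0 : NonZero k
    k≢0 = >-nonZero (≤-trans (s≤s z≤n) k≥2)

  Rich : ℕ → ℕ → Set
  Rich V Q = ∀ x → 1 ≤ x → Coprime x Q → q ^ V ∣ f (Q * x)

  -- `Q` is a product of `V` distinct primes, each contributing a factor `q`. As in Euclid's proof,
  -- the next prime is taken from the divisors of `suc (M * Q)`.
  richCoprime : ∀ V M → 1 ≤ M → ∃ λ Q → 1 ≤ Q × Coprime M Q × Rich V Q
  richCoprime zero    M _   = 1 , s≤s z≤n , Coprime.sym (Coprime.1-coprimeTo M) , λ _ _ _ → 1∣ _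
  richCoprime (suc V) M M≥1 with richCoprime V M M≥1
  ... | Q , Q≥1 , M⊥Q , rich with primeDivisor (suc (M * Q)) (s≤s (*-mono-≤ M≥1 Q≥1))
  ... | p , pp , p∣ = p * Q , *-mono-≤ (prime>0 pp) Q≥1 , coprime-*ʳ M⊥p M⊥Q , rich'
    where
    p∤MQ : ¬ p ∣ M * Q
    p∤MQ p∣MQ = prime∤1 pp (∣m+n∣m⇒∣n (subst (p ∣_) (+-comm 1 (M * Q)) p∣) p∣MQ)
    M⊥p : Coprime M p
    M⊥p = prime∤⇒coprime pp (p∤MQ ∘ ∣m⇒∣m*n Q)
    rich' : Rich (suc V) (p * Q)
    rich' x x≥1 x⊥pQ = subst (λ z → q ^ suc V ∣ f z) (sym (*-assoc p Q x))
      (∣-trans (*-monoʳ-∣ q (rich x x≥1 (coprime-factorʳ (n∣m*n p) x⊥pQ)))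
               (f-prime* pp (*-mono-≤ Q≥1 x≥1)
                 ([ p∤MQ ∘ ∣n⇒∣m*n M , p∤x ]′ ∘ euclidsLemma Q x pp)))
      where
      p∤x : ¬ p ∣ x
      p∤x p∣x = ¬prime[1] (subst Prime (x⊥pQ (p∣x , m∣m*n Q)) pp)

  Row : Set
  Row = ∃₂ λ l r → r < k ^ l

  index : Row → ℕ → ℕ
  index (l , r , _) n = k ^ l * n + r

  index-positive : ∀ row {n} → 1 ≤ n → 1 ≤ index row n
  index-positive (l , r , _) n≥1 = ≤-trans (*-mono-≤ (m^n>0 k l) n≥1) (m≤m+n _ r)

  -- Each row imposes index row n ≡ Q (mod Q²), so that the cofactor of Q is coprime to Q.
  column : ∀ V (rows : List Row) → ∃₂ λ n₀ M → 1 ≤ M ×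
    (∀ z → All (λ row → q ^ V ∣ f (index row (n₀ + M * z))) rows)
  column V [] = 0 , 1 , s≤s z≤n , λ _ → []
  column V (row@(l , r , _) ∷ rows) with column V rows
  ... | n₀ , M , M≥1 , good with richCoprime V (k ^ l * M) (*-mono-≤ (m^n>0 k l) M≥1)
  -- The column stays in the class of `n₀` modulo `M`, which keeps the earlier rows good. The
  -- unknown `z₀` has coefficient `k ^ l * M`, and `Q` was chosen coprime to it.
  ... | Q , Q≥1 , kM⊥Q , rich with solveCongruence (k ^ l * M) (k ^ l * n₀ + r) Q (Q * Q)
        (*-mono-≤ (m^n>0 k l) M≥1) (*-mono-≤ Q≥1 Q≥1) (coprime-*ʳ kM⊥Q kM⊥Q)
  ... | z₀ , y , eq = n₀ + M * z₀ , M * (Q * Q) , *-mono-≤ M≥1 (*-mono-≤ Q≥1 Q≥1) , λ z → new z ∷ old z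
    where
    old : ∀ z → All (λ row → q ^ V ∣ f (index row (n₀ + M * z₀ + M * (Q * Q) * z))) rows
    old z = subst (λ n → All (λ row → q ^ V ∣ f (index row n)) rows) (lem n₀ M z₀ (Q * Q) z)
                  (good (z₀ + Q * Q * z))
      where
      lem : ∀ n M z₀ Q z → n + M * (z₀ + Q * z) ≡ n + M * z₀ + M * Q * z
      lem = solve-∀
    new : ∀ z → q ^ V ∣ f (index row (n₀ + M * z₀ + M * (Q * Q) * z))
    new z = subst (λ n → q ^ V ∣ f n) (sym factored) (rich (1 + Q * w) (s≤s z≤n) coprime)
      where
      w = y + k ^ l * M * z
      coprime : Coprime (1 + Q * w) Q
      coprime {d} (d∣ , d∣Q) = ∣1⇒≡1 (∣m+n∣m⇒∣n (subst (d ∣_) (+-comm 1 (Q * w)) d∣) (∣m⇒∣m*n w d∣Q))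
      lem₁ : ∀ K n M z₀ Q z r → K * (n + M * z₀ + M * Q * z) + r ≡ (K * M * z₀ + (K * n + r)) + Q * (K * M * z)
      lem₁ = solve-∀
      lem₂ : ∀ Q y x → Q + Q * Q * y + Q * Q * x ≡ Q * (1 + Q * (y + x))
      lem₂ = solve-∀
      factored : index row (n₀ + M * z₀ + M * (Q * Q) * z) ≡ Q * (1 + Q * w)
      factored = trans (lem₁ (k ^ l) n₀ M z₀ (Q * Q) z r)
        (trans (cong (_+ Q * Q * (k ^ l * M * z)) eq) (lem₂ Q y (k ^ l * M * z)))

  diagonalRow : ∀ n → 1 ≤ n → ∃ λ (ρ : Row) → ¬ q ^ b ∣ f (index ρ n)
  diagonalRow n n≥1 = fromLeading (leadingPower k≥2 5 n n≥1)
    where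
    fromLeading : (∃₂ λ a C → ∃ λ l → k ^ l * n ≤ (suc k ^ a * k ^ C) ^ 6 × (suc k ^ a * k ^ C) ^ 6 < k ^ l * suc n) →
      ∃ λ (ρ : Row) → ¬ q ^ b ∣ f (index ρ n)
    fromLeading (a , C , l , lo , hi) = remainder _ lo hi (f-smooth a C)
      where
      remainder : ∀ X → k ^ l * n ≤ X → X < k ^ l * suc n → ¬ q ^ b ∣ f X → ∃ λ (ρ : Row) → ¬ q ^ b ∣ f (index ρ n)
      remainder X lo hi ∤ =
        -- The row is read off from `X`: its remainder is what is left after the leading part
        -- `k ^ l * n`, and it is below `k ^ l` by `hi`.
        (l , X ∸ k ^ l * n , +-cancelˡ-< (k ^ l * n) _ _
          (subst₂ _<_ (sym (m+[n∸m]≡n lo)) (trans (*-suc (k ^ l) n) (+-comm (k ^ l) (k ^ l * n))) hi)) ,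
        subst (λ z → ¬ q ^ b ∣ f z) (sym (m+[n∸m]≡n lo)) ∤

  -- The newest entry stands first, so `AllPairs` relates each column to the rows chosen before it.
  Triangle : ℕ → List (Row × ℕ) → Set
  Triangle V xs = All (λ (ρ , n) → ¬ pos (q ^ b) ∣ℤ seq₁ f (index ρ n)) xs ×
    AllPairs (λ (_ , n) (ρ , _) → pos (q ^ V) ∣ℤ seq₁ f (index ρ n)) xs

  triangle-∷ : ∀ V {xs} n → 1 ≤ n → All (λ ρ → q ^ V ∣ f (index ρ n)) (map proj₁ xs) →
    (∃ λ (ρ : Row) → ¬ q ^ b ∣ f (index ρ n)) → Triangle V xs → ∃ λ ρ → Triangle V ((ρ , n) ∷ xs)
  triangle-∷ V n n≥1 divisible (ρ₀ , ∤) (diag , off) = ρ₀ ,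
    (λ ∣ → ∤ (∣⇒∣ᵤ (subst (pos (q ^ b) ∣ℤ_) (seq₁-positive f (index-positive ρ₀ n≥1)) ∣))) ∷ diag ,
    All.map (λ { {ρ , _} ∣ → subst (pos (q ^ V) ∣ℤ_) (sym (seq₁-positive f (index-positive ρ n≥1))) (∣ᵤ⇒∣ ∣) })
      (All.map⁻ divisible) ∷ off

  triangle : ∀ V t → ∃ λ xs → length xs ≡ t × Triangle V xs
  triangle V zero    = [] , refl , [] , []
  triangle V (suc t) = extend (triangle V t)
    where
    extend : (∃ λ xs → length xs ≡ t × Triangle V xs) → ∃ λ xs → length xs ≡ suc t × Triangle V xs
    extend (xs , len , tri) = extendBy (column V (map proj₁ xs))
      where
      extendBy : (∃₂ λ n₀ M → 1 ≤ M × (∀ z → All (λ ρ → q ^ V ∣ f (index ρ (n₀ + M * z))) (map proj₁ xs))) →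
        ∃ λ xs → length xs ≡ suc t × Triangle V xs
      extendBy (n₀ , M , M≥1 , good) =
        let ρ , tri' = triangle-∷ V n n≥1 (good 1) (diagonalRow n n≥1) tri in (ρ , n) ∷ xs , cong suc len , tri'
        where
        -- The choice `z = 1` makes the column positive even if `n₀` is 0, so the value of `seq₁ f`
        -- at index 0 never enters.
        n = n₀ + M * 1
        n≥1 : 1 ≤ n
        n≥1 = ≤-trans M≥1 (≤-trans (≤-reflexive (sym (*-identityʳ M))) (m≤n+m (M * 1) n₀))

  notRegular : ¬ IsRegular k (seq₁ f)
  -- One more entry than there are generators; each of the `m` eliminations doubles `b`, whence
  -- `V = b * 2 ^ m`.
  notRegular (m , g , span) = contradict (triangle (b * 2 ^ m) (suc m))
    where
    coeff : Row → Fin m → ℤ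
    coeff (l , r , r<) = proj₁ (span l r r<)
    expand : ∀ ρ n → seq₁ f (index ρ n) ≡ linComb m (coeff ρ) g n
    expand (l , r , r<) = proj₂ (span l r r<)
    contradict : ¬ ∃ λ xs → length xs ≡ suc m × Triangle (b * 2 ^ m) xs
    contradict (xs , len , diag , off) = noTriangle pq m coeff g b (b * 2 ^ m) ≤-refl xs len
      (All.map (λ { {ρ , n} → subst (λ z → ¬ pos (q ^ b) ∣ℤ z) (expand ρ n) }) diag)
      (AllPairs.map (λ { {_ , n} {ρ , _} → subst (pos (q ^ (b * 2 ^ m)) ∣ℤ_) (expand ρ n) }) off)

-- The three sequences

prime[3] : Prime 3
prime[3] = from-yes (prime? 3)

τ-prime* : ∀ {p} → Prime p → ∀ {x} → 1 ≤ x → ¬ p ∣ x → τ (p * x) ≡ 2 * τ x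
τ-prime* {p} pp {x} x≥1 p∤x = trans (cong (λ z → τ (z * x)) (sym (*-identityʳ p))) (τ-primePower pp 1 x≥1 p∤x)

∤1+multiple : ∀ {q n} → 2 ≤ q → q ∣ n → ¬ q ^ 1 ∣ 1 + n
∤1+multiple {q} {n} q≥2 q∣n q∣ = <⇒≢ q≥2 (sym (∣1⇒≡1 (∣m+n∣m⇒∣n (subst₂ _∣_ (*-identityʳ q) (+-comm 1 n) q∣) q∣n)))

smooth>0 : ∀ {k} → 2 ≤ k → ∀ a C → 1 ≤ suc k ^ a * k ^ C
smooth>0 {k} k≥2 a C = *-mono-≤ (m^n>0 (suc k) a) (m^n>0 k {{>-nonZero (≤-trans (s≤s z≤n) k≥2)}} C)

ρ-notRegular : ∀ {k} → 2 ≤ k → ¬ IsRegular k (seq₁ ρ)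
ρ-notRegular {k} k≥2 = notRegular k≥2 prime[2] ρ
  -- Primes dividing a product of powers of `k` and `suc k` are at most `suc k`, so there are at
  -- most `suc k` of them and `ρ` stays below `2 ^ suc (suc k)`.
  (λ pp x≥1 p∤x → ∣-reflexive (cong (2 ^_) (sym (ω-prime* pp x≥1 p∤x)))) (suc (suc k)) smooth
  where
  smooth : ∀ a C → ¬ 2 ^ suc (suc k) ∣ ρ ((suc k ^ a * k ^ C) ^ 6)
  smooth a C 2∣ = <⇒≱ (^-monoʳ-< 2 ≤-refl (s≤s bounded)) (∣⇒≤ {{m^n≢0 2 (ω X)}} 2∣)
    where
    X = (suc k ^ a * k ^ C) ^ 6
    bounded : ω X ≤ suc k
    bounded = ω-bounded (suc k) (m^n>0 (suc k ^ a * k ^ C) {{>-nonZero (smooth>0 k≥2 a C)}} 6) λ {p} pp p∣X →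
      [ ∣⇒≤ ∘ prime∣^⇒prime∣ pp (suc k) a
      , (λ p∣ → m≤n⇒m≤1+n (∣⇒≤ {{>-nonZero (≤-trans (s≤s z≤n) k≥2)}} (prime∣^⇒prime∣ pp k C p∣))) ]′
      (euclidsLemma (suc k ^ a) (k ^ C) pp (prime∣^⇒prime∣ pp _ 6 p∣X))

-- A new prime has exponent 2 in the square and so contributes a factor 3, whereas the square of a
-- sixth power is again a sixth power, with `τ` congruent to 1 modulo 3.
τn²-notRegular : ∀ {k} → 2 ≤ k → ¬ IsRegular k (seq₁ (λ n → τ (n * n)))
τn²-notRegular {k} k≥2 = notRegular k≥2 prime[3] (λ n → τ (n * n)) triple 1 smooth
  where
  triple : ∀ {p} → Prime p → ∀ {x} → 1 ≤ x → ¬ p ∣ x → 3 * τ (x * x) ∣ τ (p * x * (p * x))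
  triple {p} pp {x} x≥1 p∤x = ∣-reflexive (sym (trans (cong τ (lem p x))
    (τ-primePower pp 2 (*-mono-≤ x≥1 x≥1) ([ p∤x , p∤x ]′ ∘ euclidsLemma x x pp))))
    where
    lem : ∀ p x → p * x * (p * x) ≡ p * (p * 1) * (x * x)
    lem = solve-∀
  smooth : ∀ a C → ¬ 3 ^ 1 ∣ τ ((suc k ^ a * k ^ C) ^ 6 * (suc k ^ a * k ^ C) ^ 6)
  smooth a C = sixthPower (suc k ^ a * k ^ C) (smooth>0 k≥2 a C)
    where
    sixthPower : ∀ y → 1 ≤ y → ¬ 3 ^ 1 ∣ τ (y ^ 6 * y ^ 6)
    sixthPower y y>0 3∣ with τ-sixthPower (y * y) (*-mono-≤ y>0 y>0)
    ... | w , eqw = ∤1+multiple {3} {6 * w} (s≤s (s≤s z≤n)) (∣m⇒∣m*n {m = 6} w (divides 2 refl))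
          (subst (3 ∣_) (trans (cong τ (sym (^-distribʳ-* y y 6))) eqw) 3∣)

-- A new prime doubles `τ`, so its square gains a factor 4, whereas `τ` is odd at sixth powers.
τ²-notRegular : ∀ {k} → 2 ≤ k → ¬ IsRegular k (seq₁ (λ n → τ n ^ 2))
τ²-notRegular {k} k≥2 = notRegular k≥2 prime[2] (λ n → τ n ^ 2) quadruple 1 smooth
  where
  quadruple : ∀ {p} → Prime p → ∀ {x} → 1 ≤ x → ¬ p ∣ x → 2 * τ x ^ 2 ∣ τ (p * x) ^ 2
  quadruple {p} pp {x} x≥1 p∤x = divides 2 (trans (cong (_^ 2) (τ-prime* pp x≥1 p∤x)) (lem (τ x)))
    where
    lem : ∀ t → 2 * t * (2 * t * 1) ≡ 2 * (2 * (t * (t * 1)))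
    lem = solve-∀
  smooth : ∀ a C → ¬ 2 ^ 1 ∣ τ ((suc k ^ a * k ^ C) ^ 6) ^ 2
  smooth a C 2∣ with τ-sixthPower (suc k ^ a * k ^ C) (smooth>0 k≥2 a C)
  ... | w , eqw = ∤1+multiple {2} {6 * w} ≤-refl (∣m⇒∣m*n {m = 6} w (divides 3 refl))
        (subst (2 ∣_) eqw (prime∣^⇒prime∣ prime[2] _ 2 2∣))

theorem3p4 : (k : ℕ) → 2 ≤ k →
    ¬ IsRegular k (seq₁ ρ) × ¬ IsRegular k (seq₁ (λ n → τ (n * n))) × ¬ IsRegular k (seq₁ (λ n → τ n ^ 2))
theorem3p4 k k≥2 = ρ-notRegular k≥2 , τn²-notRegular k≥2 , τ²-notRegular k≥2
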